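{- Let $\sigma$ be a propositional signature, and let all formulas be infinitary formulas over $\sigma$. For any set $\mathcal{H}$ of formulas (not required to be bounded) and any formulas $F$, $G$: (a) if $F$ is a theorem of the extended system, then $\mathcal{H}\cup\{F\}$ has the same stable models as $\mathcal{H}$; (b) if $F$ is equivalent to $G$ in the extended system, then $\mathcal{H}\cup\{F\}$ and $\mathcal{H}\cup\{G\}$ have the same stable models.
   Context: Formulas. A propositional signature $\sigma$ is a set of propositional atoms. Put $\mathcal{F}^\sigma_0=\sigma$, and let $\mathcal{F}^\sigma_{i+1}$ ($i\in\mathbb{N}$) be obtained from $\mathcal{F}^\sigma_i$ by adding the expressions $\mathcal{H}^\lor$ (disjunction) and $\mathcal{H}^\land$ (conjunction) for all subsets $\mathcal{H}\subseteq\mathcal{F}^\sigma_i$, of any cardinality, and the expressions $F\rightarrow G$ for all $F,G\in\mathcal{F}^\sigma_i$. The elements of $\bigcup_{i=0}^\infty\mathcal{F}^\sigma_i$ are the (infinitary) formulas over $\sigma$. A set of formulas is bounded if it is contained in some $\mathcal{F}^\sigma_i$; $\mathcal{H}^\land$ and $\mathcal{H}^\lor$ are formulas for bounded $\mathcal{H}$. Abbreviations: $\bot$ is $\emptyset^\lor$; $\neg F$ is $F\rightarrow\bot$; $F\land G$ is $\{F,G\}^\land$; $F\lor G$ is $\{F,G\}^\lor$; $F\leftrightarrow G$ is $(F\rightarrow G)\land(G\rightarrow F)$; for a bounded family $\{F_\alpha\}_{\alpha\in A}$, $\bigwedge_{\alpha\in A}F_\alpha$ is $\{F_\alpha:\alpha\in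 A\}^\land$ and $\bigvee_{\alpha\in A}F_\alpha$ is $\{F_\alpha:\alpha\in A\}^\lor$. Satisfaction. An interpretation is a subset $I\subseteq\sigma$. $I\models p$ iff $p\in I$ for $p\in\sigma$; $I\models\mathcal{H}^\land$ iff $I\models F$ for every $F\in\mathcal{H}$; $I\models\mathcal{H}^\lor$ iff $I\models F$ for some $F\in\mathcal{H}$; $I\models F\rightarrow G$ iff $I\not\models F$ or $I\models G$. $I$ satisfies a set of formulas if it satisfies all its elements. Reduct and stable models. The reduct $F^I$ of $F$ with respect to $I$: for $p\in\sigma$, $p^I=p$ if $I\models p$ and $p^I=\bot$ otherwise; $(\mathcal{H}^\land)^I=\{G^I\mid G\in\mathcal{H}\}^\land$; $(\mathcal{H}^\lor)^I=\{G^I\mid G\in\mathcal{H}\}^\lor$; $(G\rightarrow H)^I=G^I\rightarrow H^I$ if $I\models G\rightarrow H$, and $\bot$ otherwise. For a set $\mathcal{H}$ of formulas, $\mathcal{H}^I=\{G^I\mid G\in\mathcal{H}\}$. $I$ is a stable model of a set $\mathcal{H}$ of formulas if $I$ is minimal with respect to set inclusion among the interpretations satisfying $\mathcal{H}^I$ (in particular $I$ satisfies $\mathcal{H}^I$). Basic system. A sequent is an expression $\Gamma\Rightarrow F$ with $F$ a formula and $\Gamma$ a finite set of formulas (written as a list, comma denoting union); $\Rightarrow F$ (empty $\Gamma$) is identified with $F$. Axioms: all sequents $F\Rightarrow F$. Inference rules ($\mathcal{H}$ ranges over bounded sets of formulas; $\Gamma,\Delta$ over finite sets of formulas): $(\land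 I)$ from $\Gamma\Rightarrow H$ for all $H\in\mathcal{H}$ infer $\Gamma\Rightarrow\mathcal{H}^\land$; $(\land E)$ from $\Gamma\Rightarrow\mathcal{H}^\land$ infer $\Gamma\Rightarrow H$ ($H\in\mathcal{H}$); $(\lor I)$ from $\Gamma\Rightarrow H$ ($H\in\mathcal{H}$) infer $\Gamma\Rightarrow\mathcal{H}^\lor$; $(\lor E)$ from $\Gamma\Rightarrow\mathcal{H}^\lor$ and $\Delta,H\Rightarrow F$ for all $H\in\mathcal{H}$ infer $\Gamma,\Delta\Rightarrow F$; $(\rightarrow I)$ from $\Gamma,F\Rightarrow G$ infer $\Gamma\Rightarrow F\rightarrow G$; $(\rightarrow E)$ from $\Gamma\Rightarrow F$ and $\Delta\Rightarrow F\rightarrow G$ infer $\Gamma,\Delta\Rightarrow G$; $(W)$ from $\Gamma\Rightarrow F$ infer $\Gamma,\Delta\Rightarrow F$. Extended system. It is obtained from the basic system by adding the following axiom schemas (each formula $A$ being identified with the sequent $\Rightarrow A$): (1) $F\lor(F\rightarrow G)\lor\neg G$ for all formulas $F,G$; (2) $\neg\bigwedge_{F\in\mathcal{H}}F\rightarrow\bigvee_{F\in\mathcal{H}}\neg F$ for every bounded set $\mathcal{H}$ of formulas; (3) $\Big(\bigwedge_{i\in I}\bigvee_{F\in\mathcal{H}_i}F\Big)\rightarrow\Big(\bigvee_{\{F_i\}_{i\in I}}\bigwedge_{i\in I}F_i\Big)$ and (4) $\Big(\bigwedge_{\{F_i\}_{i\in I}}\bigvee_{i\in I}F_i\Big)\rightarrow\Big(\bigvee_{i\in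 I}\bigwedge_{F\in\mathcal{H}_i}F\Big)$ for every non-empty family $\{\mathcal{H}_i\}_{i\in I}$ of sets of formulas whose union is bounded, where the outer disjunction in the consequent of (3) and the outer conjunction in the antecedent of (4) extend over all elements $\{F_i\}_{i\in I}$ of the Cartesian product of the family $\{\mathcal{H}_i\}_{i\in I}$ (here $I$ is an index set, not an interpretation). The set of theorems of the extended system is the smallest set of sequents containing all its axioms and closed under the inference rules. Formulas $F$ and $G$ are equivalent in the extended system if $F\leftrightarrow G$ is a theorem of the extended system. -}

module Defs where

open import Axiom.ExcludedMiddle using (ExcludedMiddle)
open import Data.Bool.Base using (Bool; true; false; if_then_else_)
open import Data.Empty.Polymorphic using (⊥)
open import Data.List.Base using (List; []; _∷_; _++_)
import Data.List.Relation.Binary.Subset.Setoid as SetoidSubset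
open import Data.Nat.Base using (ℕ; suc; _≤′_; ≤′-reflexive; ≤′-step) renaming (_⊔_ to max)
open import Data.Nat.Properties using (≤⇒≤′; m≤m⊔n; m≤n⊔m)
open import Data.Product.Base using (∃; _×_; _,_; proj₁; proj₂)
open import Data.Sum.Base using (_⊎_)
open import Function.Base using (_∘_)
open import Function.Bundles using (_⇔_)
open import Level using (Level; Lift; lift; _⊔_) renaming (suc to lsuc)
open import Relation.Binary.Bundles using (Setoid)
open import Relation.Binary.PropositionalEquality.Core using (_≡_; refl; sym; trans)
open import Relation.Nullary.Decidable.Core using (does)
open import Relation.Nullary.Negation.Core using (¬_)
open import Relation.Unary using (Pred; _∈_; _⊆_)

private variable
  ℓ h h′ : Level
  σ : Set ℓ
  i j : ℕ

-- A set of expressions is presented as a family f : A → Expr σ with A in the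
-- universe of σ; repetitions and the choice of A are disregarded by _≈ᵉ_ below.
-- Excluded middle makes this cover all subsets of each level 𝓕 i: up to _≈ᵉ_,
-- 𝓕 0 is indexed by C₀ = σ, and 𝓕 (i + 1) by the type
-- Cᵢ ⊎ (Cᵢ → Bool) ⊎ (Cᵢ → Bool) ⊎ Cᵢ × Cᵢ, again in Set ℓ, so that any
-- subset of 𝓕 i is a family indexed by a subtype of Cᵢ.

data Expr {ℓ} (σ : Set ℓ) : Set (lsuc ℓ) where
  atom : σ → Expr σ
  conj : {A : Set ℓ} → (A → Expr σ) → Expr σ
  disj : {A : Set ℓ} → (A → Expr σ) → Expr σ
  imp  : Expr σ → Expr σ → Expr σ

-- 𝓕 i E says that E belongs to the i-th stage of the hierarchy. Expr itself
-- also contains expressions of infinite rank, which lie in no stage.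

data 𝓕 {ℓ} {σ : Set ℓ} : ℕ → Expr σ → Set (lsuc ℓ) where
  atom : (p : σ) → 𝓕 0 (atom p)
  keep : ∀ {i E} → 𝓕 i E → 𝓕 (suc i) E
  conj : ∀ {i} {A : Set ℓ} {f : A → Expr σ} → (∀ a → 𝓕 i (f a)) → 𝓕 (suc i) (conj f)
  disj : ∀ {i} {A : Set ℓ} {f : A → Expr σ} → (∀ a → 𝓕 i (f a)) → 𝓕 (suc i) (disj f)
  imp  : ∀ {i D E} → 𝓕 i D → 𝓕 i E → 𝓕 (suc i) (imp D E)

record Formula {ℓ} (σ : Set ℓ) : Set (lsuc ℓ) where
  constructor formula
  field
    expr   : Expr σ
    ranked : ∃ λ i → 𝓕 i expr

open Formula public

-- Identity of expressions, with conjunctions and disjunctions taken of sets: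
-- two families are identified when they have the same members.

infix 4 _≈ᵉ_ _≈_

_≈ᵉ_ : {σ : Set ℓ} → Expr σ → Expr σ → Set ℓ
atom p  ≈ᵉ atom q    = p ≡ q
conj f  ≈ᵉ conj g    = (∀ a → ∃ λ b → f a ≈ᵉ g b) × (∀ b → ∃ λ a → f a ≈ᵉ g b)
disj f  ≈ᵉ disj g    = (∀ a → ∃ λ b → f a ≈ᵉ g b) × (∀ b → ∃ λ a → f a ≈ᵉ g b)
imp D E ≈ᵉ imp D′ E′ = (D ≈ᵉ D′) × (E ≈ᵉ E′)
_       ≈ᵉ _         = ⊥

≈ᵉ-refl : (E : Expr σ) → E ≈ᵉ E
≈ᵉ-refl (atom p)  = refl
≈ᵉ-refl (conj f)  = (λ a → a , ≈ᵉ-refl (f a)) , (λ a → a , ≈ᵉ-refl (f a))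
≈ᵉ-refl (disj f)  = (λ a → a , ≈ᵉ-refl (f a)) , (λ a → a , ≈ᵉ-refl (f a))
≈ᵉ-refl (imp D E) = ≈ᵉ-refl D , ≈ᵉ-refl E

≈ᵉ-sym : (D E : Expr σ) → D ≈ᵉ E → E ≈ᵉ D
≈ᵉ-sym (atom p)  (atom q)    e       = sym e
≈ᵉ-sym (conj f)  (conj g)    (l , r) =
  (λ b → proj₁ (r b) , ≈ᵉ-sym (f (proj₁ (r b))) (g b) (proj₂ (r b))) ,
  (λ a → proj₁ (l a) , ≈ᵉ-sym (f a) (g (proj₁ (l a))) (proj₂ (l a)))
≈ᵉ-sym (disj f)  (disj g)    (l , r) =
  (λ b → proj₁ (r b) , ≈ᵉ-sym (f (proj₁ (r b))) (g b) (proj₂ (r b))) ,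
  (λ a → proj₁ (l a) , ≈ᵉ-sym (f a) (g (proj₁ (l a))) (proj₂ (l a)))
≈ᵉ-sym (imp D E) (imp D′ E′) (d , e) = ≈ᵉ-sym D D′ d , ≈ᵉ-sym E E′ e

≈ᵉ-trans : (C D E : Expr σ) → C ≈ᵉ D → D ≈ᵉ E → C ≈ᵉ E
≈ᵉ-trans (atom p) (atom q) (atom r) d e = trans d e
≈ᵉ-trans (conj f) (conj g) (conj k) (l , r) (l′ , r′) =
  (λ a → let (b , d) = l a ; (c , e) = l′ b in c , ≈ᵉ-trans (f a) (g b) (k c) d e) ,
  (λ c → let (b , e) = r′ c ; (a , d) = r b in a , ≈ᵉ-trans (f a) (g b) (k c) d e)
≈ᵉ-trans (disj f) (disj g) (disj k) (l , r) (l′ , r′) =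
  (λ a → let (b , d) = l a ; (c , e) = l′ b in c , ≈ᵉ-trans (f a) (g b) (k c) d e) ,
  (λ c → let (b , e) = r′ c ; (a , d) = r b in a , ≈ᵉ-trans (f a) (g b) (k c) d e)
≈ᵉ-trans (imp C D) (imp C′ D′) (imp C″ D″) (c , d) (c′ , d′) =
  ≈ᵉ-trans C C′ C″ c c′ , ≈ᵉ-trans D D′ D″ d d′

_≈_ : {σ : Set ℓ} → Formula σ → Formula σ → Set ℓ
F ≈ G = expr F ≈ᵉ expr G

formulaSetoid : (σ : Set ℓ) → Setoid (lsuc ℓ) ℓ
formulaSetoid σ = record
  { Carrier       = Formula σ
  ; _≈_           = _≈_
  ; isEquivalence = record
    { refl  = λ {F} → ≈ᵉ-refl (expr F)
    ; sym   = λ {F} {G} → ≈ᵉ-sym (expr F) (expr G)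
    ; trans = λ {F} {G} {H} → ≈ᵉ-trans (expr F) (expr G) (expr H)
    }
  }

record BoundedSet {ℓ} (σ : Set ℓ) : Set (lsuc ℓ) where
  field
    Index   : Set ℓ
    elem    : Index → Formula σ
    bounded : ∃ λ i → ∀ a → 𝓕 i (expr (elem a))

⋀ ⋁ : BoundedSet σ → Formula σ
⋀ record { elem = elem ; bounded = i , r } = formula (conj (expr ∘ elem)) (suc i , conj r)
⋁ record { elem = elem ; bounded = i , r } = formula (disj (expr ∘ elem)) (suc i , disj r)

private
  𝓕-mono′ : {E : Expr σ} → i ≤′ j → 𝓕 i E → 𝓕 j E
  𝓕-mono′ (≤′-reflexive refl) r = r
  𝓕-mono′ (≤′-step i≤j)       r = keep (𝓕-mono′ i≤j r)

𝓕-maxˡ : {E : Expr σ} → ∀ i j → 𝓕 i E → 𝓕 (max i j) E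
𝓕-maxˡ i j = 𝓕-mono′ (≤⇒≤′ (m≤m⊔n i j))

𝓕-maxʳ : {E : Expr σ} → ∀ i j → 𝓕 j E → 𝓕 (max i j) E
𝓕-maxʳ i j = 𝓕-mono′ (≤⇒≤′ (m≤n⊔m i j))

infixr 5 _⟶_
infix  4 _⟷_
infixl 7 _∧_
infixl 6 _∨_
infix  8 ~_

_⟶_ : Formula σ → Formula σ → Formula σ
formula D (i , d) ⟶ formula E (j , e) =
  formula (imp D E) (suc (max i j) , imp (𝓕-maxˡ i j d) (𝓕-maxʳ i j e))

∅ : BoundedSet σ
∅ = record { Index = ⊥ ; elem = λ () ; bounded = 0 , λ () }

pair : Formula σ → Formula σ → BoundedSet σ
pair {σ = σ} F G = record
  { Index   = Lift _ Bool
  ; elem    = el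
  ; bounded = max m n , λ
    { (lift true)  → 𝓕-maxˡ m n (proj₂ (ranked F))
    ; (lift false) → 𝓕-maxʳ m n (proj₂ (ranked G)) }
  }
  where
  m = proj₁ (ranked F)
  n = proj₁ (ranked G)
  el : Lift _ Bool → Formula σ
  el (lift true)  = F
  el (lift false) = G

⊥ᶠ : Formula σ
⊥ᶠ = ⋁ ∅

~_ : Formula σ → Formula σ
~ F = F ⟶ ⊥ᶠ

_∧_ _∨_ _⟷_ : Formula σ → Formula σ → Formula σ
F ∧ G = ⋀ (pair F G)
F ∨ G = ⋁ (pair F G)
F ⟷ G = (F ⟶ G) ∧ (G ⟶ F)

Interpretation : Set ℓ → Set (lsuc ℓ)
Interpretation {ℓ} σ = Pred σ ℓ

infix 4 _⊨ᵉ_ _⊨_ _⊨ˢ_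

_⊨ᵉ_ : {σ : Set ℓ} → Interpretation σ → Expr σ → Set ℓ
I ⊨ᵉ atom p  = p ∈ I
I ⊨ᵉ conj f  = ∀ a → I ⊨ᵉ f a
I ⊨ᵉ disj f  = ∃ λ a → I ⊨ᵉ f a
I ⊨ᵉ imp D E = ¬ (I ⊨ᵉ D) ⊎ (I ⊨ᵉ E)

_⊨_ : {σ : Set ℓ} → Interpretation σ → Formula σ → Set ℓ
I ⊨ F = I ⊨ᵉ expr F

_⊨ˢ_ : {σ : Set ℓ} → Interpretation σ → Pred (Formula σ) h → Set (lsuc ℓ ⊔ h)
I ⊨ˢ H = ∀ F → F ∈ H → I ⊨ F

-- The reduct is defined by cases on whether I satisfies a formula, so it
-- takes excluded middle as an argument.

reductᵉ : {σ : Set ℓ} → ExcludedMiddle ℓ → Interpretation σ → Expr σ → Expr σ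
reductᵉ em I (atom p)  = if does (em {I ⊨ᵉ atom p}) then atom p else expr ⊥ᶠ
reductᵉ em I (conj f)  = conj (λ a → reductᵉ em I (f a))
reductᵉ em I (disj f)  = disj (λ a → reductᵉ em I (f a))
reductᵉ em I (imp D E) =
  if does (em {I ⊨ᵉ imp D E}) then imp (reductᵉ em I D) (reductᵉ em I E) else expr ⊥ᶠ

-- The stage may go up by one, since an atom can turn into ⊥ = ∅^∨.

𝓕-reduct : {σ : Set ℓ} (em : ExcludedMiddle ℓ) (I : Interpretation σ) {E : Expr σ} →
  𝓕 i E → 𝓕 (suc i) (reductᵉ em I E)
𝓕-reduct em I (atom p) with does (em {I ⊨ᵉ atom p})
... | true  = keep (atom p)
... | false = disj λ ()
𝓕-reduct em I (keep r) = keep (𝓕-reduct em I r)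
𝓕-reduct em I (conj r) = conj λ a → 𝓕-reduct em I (r a)
𝓕-reduct em I (disj r) = disj λ a → 𝓕-reduct em I (r a)
𝓕-reduct em I (imp {D = D} {E = E} r s) with does (em {I ⊨ᵉ imp D E})
... | true  = imp (𝓕-reduct em I r) (𝓕-reduct em I s)
... | false = disj λ ()

reduct : {σ : Set ℓ} → ExcludedMiddle ℓ → Interpretation σ → Formula σ → Formula σ
reduct em I (formula E (i , r)) = formula (reductᵉ em I E) (suc i , 𝓕-reduct em I r)

reductˢ : {σ : Set ℓ} → ExcludedMiddle ℓ → Interpretation σ →
  Pred (Formula σ) h → Pred (Formula σ) (lsuc ℓ ⊔ h)
reductˢ em I H F = ∃ λ G → G ∈ H × F ≈ reduct em I G

StableModel : {σ : Set ℓ} → ExcludedMiddle ℓ →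
  Pred (Formula σ) h → Interpretation σ → Set (lsuc ℓ ⊔ h)
StableModel em H I =
  I ⊨ˢ reductˢ em I H × (∀ J → J ⊨ˢ reductˢ em I H → J ⊆ I → I ⊆ J)

SameStableModels : {σ : Set ℓ} → ExcludedMiddle ℓ →
  Pred (Formula σ) h → Pred (Formula σ) h′ → Set (lsuc ℓ ⊔ h ⊔ h′)
SameStableModels em H H′ = ∀ I → StableModel em H I ⇔ StableModel em H′ I

⟦_⟧ : {σ : Set ℓ} → Formula σ → Pred (Formula σ) ℓ
⟦ F ⟧ G = F ≈ G

-- The left side of a sequent is a finite set, presented by a list.

infix 4 _≋_

_≋_ : {σ : Set ℓ} → List (Formula σ) → List (Formula σ) → Set (lsuc ℓ)
_≋_ {σ = σ} Γ Δ = (Γ ⊆ˢ Δ) × (Δ ⊆ˢ Γ)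
  where open SetoidSubset (formulaSetoid σ) renaming (_⊆_ to _⊆ˢ_)

-- Derivability in the basic system with additional axioms Ax. The rule `same`
-- identifies sequents that differ only in the presentation of the sets
-- occurring in them.

data Derivable {ℓ} {σ : Set ℓ} (Ax : Pred (Formula σ) (lsuc ℓ)) :
    List (Formula σ) → Formula σ → Set (lsuc ℓ) where
  same : ∀ {Γ Δ F G} → Γ ≋ Δ → F ≈ G → Derivable Ax Γ F → Derivable Ax Δ G
  ax   : ∀ {A} → A ∈ Ax → Derivable Ax [] A
  hyp  : ∀ F → Derivable Ax (F ∷ []) F
  ∧I   : ∀ {Γ} (H : BoundedSet σ) →
         (∀ a → Derivable Ax Γ (BoundedSet.elem H a)) → Derivable Ax Γ (⋀ H)
  ∧E   : ∀ {Γ} (H : BoundedSet σ) →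
         Derivable Ax Γ (⋀ H) → ∀ a → Derivable Ax Γ (BoundedSet.elem H a)
  ∨I   : ∀ {Γ} (H : BoundedSet σ) →
         ∀ a → Derivable Ax Γ (BoundedSet.elem H a) → Derivable Ax Γ (⋁ H)
  ∨E   : ∀ {Γ Δ F} (H : BoundedSet σ) →
         Derivable Ax Γ (⋁ H) → (∀ a → Derivable Ax (BoundedSet.elem H a ∷ Δ) F) →
         Derivable Ax (Γ ++ Δ) F
  →I   : ∀ {Γ F G} → Derivable Ax (F ∷ Γ) G → Derivable Ax Γ (F ⟶ G)
  →E   : ∀ {Γ Δ F G} → Derivable Ax Γ F → Derivable Ax Δ (F ⟶ G) →
         Derivable Ax (Γ ++ Δ) G
  W    : ∀ {Γ F} Δ → Derivable Ax Γ F → Derivable Ax (Γ ++ Δ) F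

negations : BoundedSet σ → BoundedSet σ
negations record { Index = Index ; elem = elem ; bounded = i , r } = record
  { Index   = Index
  ; elem    = λ a → ~ elem a
  ; bounded = suc (max i 1) , λ a → imp (𝓕-maxˡ i 1 (r a)) (𝓕-maxʳ i 1 (disj λ ()))
  }

-- A non-empty family {Hᵢ} of sets of formulas with bounded union;
-- Hᵢ = { elem i a : a ∈ Member i }.

record BoundedFamily {ℓ} (σ : Set ℓ) : Set (lsuc ℓ) where
  field
    Index    : Set ℓ
    nonempty : Index
    Member   : Index → Set ℓ
    elem     : ∀ i → Member i → Formula σ
    bounded  : ∃ λ n → ∀ i a → 𝓕 n (expr (elem i a))

  private n = proj₁ bounded

  -- An element {Fᵢ} of the Cartesian product of the Hᵢ is given by a choice
  -- function c, with Fᵢ = elem i (c i).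

  Choice : Set ℓ
  Choice = ∀ i → Member i

  component : Index → BoundedSet σ
  component i = record
    { Index = Member i ; elem = elem i ; bounded = n , proj₂ bounded i }

  selection : Choice → BoundedSet σ
  selection c = record
    { Index = Index ; elem = λ i → elem i (c i) ; bounded = n , λ i → proj₂ bounded i (c i) }

  ⋀⋁-components ⋁⋀-components ⋁⋀-selections ⋀⋁-selections : Formula σ
  ⋀⋁-components = ⋀ record
    { Index = Index ; elem = λ i → ⋁ (component i)
    ; bounded = suc n , λ i → disj (proj₂ bounded i) }
  ⋁⋀-components = ⋁ record
    { Index = Index ; elem = λ i → ⋀ (component i)
    ; bounded = suc n , λ i → conj (proj₂ bounded i) }
  ⋁⋀-selections = ⋁ record
    { Index = Choice ; elem = λ c → ⋀ (selection c)
    ; bounded = suc n , λ c → conj λ i → proj₂ bounded i (c i) }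
  ⋀⋁-selections = ⋀ record
    { Index = Choice ; elem = λ c → ⋁ (selection c)
    ; bounded = suc n , λ c → disj λ i → proj₂ bounded i (c i) }

data ExtendedAxiom {ℓ} {σ : Set ℓ} : Formula σ → Set (lsuc ℓ) where
  ax₁ : ∀ F G → ExtendedAxiom (F ∨ (F ⟶ G) ∨ ~ G)
  ax₂ : ∀ H → ExtendedAxiom (~ ⋀ H ⟶ ⋁ (negations H))
  ax₃ : ∀ (𝓗 : BoundedFamily σ) →
        ExtendedAxiom (BoundedFamily.⋀⋁-components 𝓗 ⟶ BoundedFamily.⋁⋀-selections 𝓗)
  ax₄ : ∀ (𝓗 : BoundedFamily σ) →
        ExtendedAxiom (BoundedFamily.⋀⋁-selections 𝓗 ⟶ BoundedFamily.⋁⋀-components 𝓗)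

Theorem : {σ : Set ℓ} → Formula σ → Set (lsuc ℓ)
Theorem F = Derivable ExtendedAxiom [] F

Equivalent : {σ : Set ℓ} → Formula σ → Formula σ → Set (lsuc ℓ)
Equivalent F G = Theorem (F ⟷ G)

{-# OPTIONS --safe #-}

-- Write J ⊩ E for J ⊨ Eᴵ. This is satisfaction in the HT-interpretation (J , I):
-- an implication holds iff I satisfies it and J ⊩ passes from its antecedent to
-- its consequent. Since J ⊩ E implies I ⊨ E, and I ⊩ E is I ⊨ E, all rules and
-- axioms of the extended system preserve validity of ⊩ in every J (for fixed I).
-- Hence adding a theorem to H, or replacing a formula by an equivalent one, does
-- not change which J satisfy the reduct of the set.
module Submission where

open import Defs
open import Axiom.DoubleNegationElimination using (em⇒dne)
open import Axiom.ExcludedMiddle using (ExcludedMiddle)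
open import Data.Bool.Base using (true; false)
open import Data.Empty using (⊥-elim)
open import Data.List.Relation.Binary.Subset.Setoid.Properties using (All-resp-⊇)
open import Data.List.Relation.Unary.All as All using (All; []; _∷_)
open import Data.List.Relation.Unary.All.Properties using (++⁻ˡ; ++⁻ʳ)
open import Data.Product.Base using (∃; _×_; _,_; proj₁; proj₂; map₂)
open import Data.Sum.Base using (inj₁; inj₂; [_,_]′)
open import Function.Base using (_∘_; const)
open import Function.Bundles using (_⇔_; mk⇔; Equivalence)
open import Level using (lift)
open import Relation.Binary.PropositionalEquality.Core using (refl)
open import Relation.Nullary.Decidable.Core using (yes; no)
open import Relation.Nullary.Negation.Core using (¬_)
open import Relation.Unary using (Pred; _∈_; _∪_)

⊨-resp-≈ᵉ : ∀ {ℓ} {σ : Set ℓ} (I : Interpretation σ) (D E : Expr σ) →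
  D ≈ᵉ E → I ⊨ᵉ D → I ⊨ᵉ E
⊨-resp-≈ᵉ I (atom p)  (atom q)    refl    x        = x
⊨-resp-≈ᵉ I (conj f)  (conj g)    (_ , r) x b      =
  let (a , e) = r b in ⊨-resp-≈ᵉ I (f a) (g b) e (x a)
⊨-resp-≈ᵉ I (disj f)  (disj g)    (l , _) (a , x)  =
  let (b , e) = l a in b , ⊨-resp-≈ᵉ I (f a) (g b) e x
⊨-resp-≈ᵉ I (imp D E) (imp D′ E′) (d , _) (inj₁ x) =
  inj₁ (x ∘ ⊨-resp-≈ᵉ I D′ D (≈ᵉ-sym D D′ d))
⊨-resp-≈ᵉ I (imp D E) (imp D′ E′) (_ , e) (inj₂ x) = inj₂ (⊨-resp-≈ᵉ I E E′ e x)

module Classical {ℓ} (em : ExcludedMiddle ℓ) where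

  ¬∀⇒∃¬ : {A : Set ℓ} {P : A → Set ℓ} → ¬ (∀ a → P a) → ∃ λ a → ¬ P a
  ¬∀⇒∃¬ ¬∀ = em⇒dne em λ ¬∃ → ¬∀ λ a → em⇒dne em λ ¬Pa → ¬∃ (a , ¬Pa)

  -- If every `a` had some `b` with `P a b` false, these values `b` would form a choice function
  -- contradicting the hypothesis. This is the core of axiom schema (4).
  ∀∃-choice⇒∃∀ : {A : Set ℓ} {B : A → Set ℓ} {P : ∀ a → B a → Set ℓ} →
    ((c : ∀ a → B a) → ∃ λ a → P a (c a)) → ∃ λ a → ∀ b → P a b
  ∀∃-choice⇒∃∀ sel = em⇒dne em λ ¬∃ →
    let counterexample = λ a → ¬∀⇒∃¬ (λ all → ¬∃ (a , all))
        (a , x)        = sel (proj₁ ∘ counterexample)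
    in proj₂ (counterexample a) x

module HereAndThere {ℓ} (em : ExcludedMiddle ℓ) {σ : Set ℓ} (I : Interpretation σ) where

  open Classical em

  infix 4 _⊩ᵉ_ _⊩_

  _⊩ᵉ_ : Interpretation σ → Expr σ → Set ℓ
  J ⊩ᵉ E = J ⊨ᵉ reductᵉ em I E

  _⊩_ : Interpretation σ → Formula σ → Set ℓ
  J ⊩ F = J ⊩ᵉ expr F

  ⊩-imp⁺ : ∀ {J} D E → I ⊨ᵉ imp D E → (J ⊩ᵉ D → J ⊩ᵉ E) → J ⊩ᵉ imp D E
  ⊩-imp⁺ {J} D E x y with em {I ⊨ᵉ imp D E}
  ... | no ¬x = ⊥-elim (¬x x)
  ... | yes _ with em {J ⊩ᵉ D}
  ...   | yes d = inj₂ (y d)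
  ...   | no ¬d = inj₁ ¬d

  ⊩-imp⁻ : ∀ {J} D E → J ⊩ᵉ imp D E → I ⊨ᵉ imp D E × (J ⊩ᵉ D → J ⊩ᵉ E)
  ⊩-imp⁻ D E x with em {I ⊨ᵉ imp D E}
  ⊩-imp⁻ D E (inj₁ ¬d)    | yes y = y , ⊥-elim ∘ ¬d
  ⊩-imp⁻ D E (inj₂ e)     | yes y = y , const e
  ⊩-imp⁻ D E (lift () , _) | no _

  -- Holds for arbitrary J, since the reduct turns every atom and every implication that is false in
  -- I into `⊥ᶠ`.
  ⊩⇒⊨ : ∀ {J} E → J ⊩ᵉ E → I ⊨ᵉ E
  ⊩⇒⊨ (atom p) x with em {I ⊨ᵉ atom p}
  ⊩⇒⊨ (atom p) x             | yes y = y
  ⊩⇒⊨ (atom p) (lift () , _) | no _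
  ⊩⇒⊨ (conj f)  x       = λ a → ⊩⇒⊨ (f a) (x a)
  ⊩⇒⊨ (disj f)  (a , x) = a , ⊩⇒⊨ (f a) x
  ⊩⇒⊨ (imp D E) x       = proj₁ (⊩-imp⁻ D E x)

  ⊨⇒⊩ : ∀ E → I ⊨ᵉ E → I ⊩ᵉ E
  ⊨⇒⊩ (atom p) x with em {I ⊨ᵉ atom p}
  ... | yes _ = x
  ... | no ¬x = ⊥-elim (¬x x)
  ⊨⇒⊩ (conj f)  x       = λ a → ⊨⇒⊩ (f a) (x a)
  ⊨⇒⊩ (disj f)  (a , x) = a , ⊨⇒⊩ (f a) x
  ⊨⇒⊩ (imp D E) x       = ⊩-imp⁺ D E x
    ([ (λ ¬d → ⊥-elim ∘ ¬d ∘ ⊩⇒⊨ D) , (λ e → const (⊨⇒⊩ E e)) ]′ x)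

  -- By direct induction rather than via identity of the reducts: these branch on `em` at two
  -- different propositions, which `⊩-imp⁻` and `⊩-imp⁺` conceal.
  ⊩-resp-≈ᵉ : ∀ {J} D E → D ≈ᵉ E → J ⊩ᵉ D → J ⊩ᵉ E
  ⊩-resp-≈ᵉ (atom p)  (atom q)    refl    x       = x
  ⊩-resp-≈ᵉ (conj f)  (conj g)    (_ , r) x b     =
    let (a , e) = r b in ⊩-resp-≈ᵉ (f a) (g b) e (x a)
  ⊩-resp-≈ᵉ (disj f)  (disj g)    (l , _) (a , x) =
    let (b , e) = l a in b , ⊩-resp-≈ᵉ (f a) (g b) e x
  ⊩-resp-≈ᵉ (imp D E) (imp D′ E′) (d , e) x       =
    let (y , z) = ⊩-imp⁻ D E x in
    ⊩-imp⁺ D′ E′ (⊨-resp-≈ᵉ I (imp D E) (imp D′ E′) (d , e) y)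
      (⊩-resp-≈ᵉ E E′ e ∘ z ∘ ⊩-resp-≈ᵉ D′ D (≈ᵉ-sym D D′ d))

  ⊩-resp-≈ : ∀ {J F G} → F ≈ G → J ⊩ F → J ⊩ G
  ⊩-resp-≈ {F = F} {G} = ⊩-resp-≈ᵉ (expr F) (expr G)

  -- The instance at I itself supplies the classical half of the implication.
  ⊩-⟶⁺ : ∀ {J} F G → (I ⊩ F → I ⊩ G) → (J ⊩ F → J ⊩ G) → J ⊩ F ⟶ G
  ⊩-⟶⁺ F G x = ⊩-imp⁺ (expr F) (expr G) I⊨F⟶G
    where
    I⊨F⟶G : I ⊨ F ⟶ G
    I⊨F⟶G with em {I ⊨ F}
    ... | yes f = inj₂ (⊩⇒⊨ (expr G) (x (⊨⇒⊩ (expr F) f)))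
    ... | no ¬f = inj₁ ¬f

  ⊩-⟶⁻ : ∀ {J} F G → J ⊩ F ⟶ G → J ⊩ F → J ⊩ G
  ⊩-⟶⁻ F G = proj₂ ∘ ⊩-imp⁻ (expr F) (expr G)

  -- Negation is decided by I alone: what fails in I fails under ⊩ at every J, by `⊩⇒⊨`.
  ⊩-~⁺ : ∀ {J} F → ¬ I ⊨ F → J ⊩ ~ F
  ⊩-~⁺ F ¬f = ⊩-imp⁺ (expr F) (expr ⊥ᶠ) (inj₁ ¬f) (⊥-elim ∘ ¬f ∘ ⊩⇒⊨ (expr F))

  ⊩-~⁻ : ∀ {J} F → J ⊩ ~ F → ¬ I ⊨ F
  ⊩-~⁻ F x f with proj₁ (⊩-imp⁻ (expr F) (expr ⊥ᶠ) x)
  ... | inj₁ ¬f            = ¬f f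
  ... | inj₂ (lift () , _)

  ⊩-axiom : ∀ {J F} → ExtendedAxiom F → J ⊩ F
  -- F is decided at J, but G at I. If F fails at J and G holds in I, the implication is true in I
  -- and vacuous at J. Since `_∨_` associates to the left, the outer tag comes first.
  ⊩-axiom {J} (ax₁ F G) with em {J ⊩ F} | em {I ⊨ G}
  ... | yes f | _     = lift true , lift true , f
  ... | no ¬f | yes g = lift true , lift false ,
    ⊩-imp⁺ (expr F) (expr G) (inj₂ g) (⊥-elim ∘ ¬f)
  ... | no ¬f | no ¬g = lift false , ⊩-~⁺ G ¬g
  ⊩-axiom (ax₂ H) = ⊩-⟶⁺ (~ ⋀ H) (⋁ (negations H)) refute refute
    where
    refute : ∀ {J} → J ⊩ ~ ⋀ H → J ⊩ ⋁ (negations H)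
    refute x = map₂ (λ {a} → ⊩-~⁺ (BoundedSet.elem H a)) (¬∀⇒∃¬ (⊩-~⁻ (⋀ H) x))
  ⊩-axiom (ax₃ 𝓗) = ⊩-⟶⁺ ⋀⋁-components ⋁⋀-selections distribute distribute
    where
    open BoundedFamily 𝓗
    distribute : ∀ {J} → J ⊩ ⋀⋁-components → J ⊩ ⋁⋀-selections
    -- The antecedent supplies a witness for each index; together they are the choice function.
    distribute x = proj₁ ∘ x , proj₂ ∘ x
  ⊩-axiom (ax₄ 𝓗) =
    ⊩-⟶⁺ ⋀⋁-selections ⋁⋀-components ∀∃-choice⇒∃∀ ∀∃-choice⇒∃∀
    where open BoundedFamily 𝓗

  -- J varies in the induction because the rule `→I` also uses its premise at I.
  soundness : ∀ {J Γ F} → Derivable ExtendedAxiom Γ F → All (J ⊩_) Γ → J ⊩ F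
  soundness (same {F = F} {G} (Γ⊆Δ , _) F≈G d) γ =
    ⊩-resp-≈ {F = F} {G} F≈G
      (soundness d (All-resp-⊇ (formulaSetoid σ) (λ {F} {G} → ⊩-resp-≈ {F = F} {G})
        (λ {E} → Γ⊆Δ {E}) γ))
  soundness (ax A∈Ax)         γ       = ⊩-axiom A∈Ax
  soundness (hyp F)           (f ∷ _) = f
  soundness (∧I H d)          γ       = λ a → soundness (d a) γ
  soundness (∧E H d a)        γ       = soundness d γ a
  soundness (∨I H a d)        γ       = a , soundness d γ
  soundness (∨E {Γ} H d e)    γ       =
    let (a , x) = soundness d (++⁻ˡ Γ γ) in soundness (e a) (x ∷ ++⁻ʳ Γ γ)
  soundness (→I {F = F} {G} d) γ      =
    -- The context moves from J to I by persistence: J ⊩ E gives I ⊨ E, hence I ⊩ E.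
    ⊩-⟶⁺ F G (λ f → soundness d (f ∷ All.map (λ {E} → ⊨⇒⊩ (expr E) ∘ ⊩⇒⊨ (expr E)) γ))
             (λ f → soundness d (f ∷ γ))
  soundness (→E {Γ} {F = F} {G} d e) γ =
    ⊩-⟶⁻ F G (soundness e (++⁻ʳ Γ γ)) (soundness d (++⁻ˡ Γ γ))
  soundness (W {Γ} Δ d)       γ       = soundness d (++⁻ˡ Γ γ)

  ⊨ˢ-reductˢ⁻ : ∀ {h J} {H : Pred (Formula σ) h} →
    J ⊨ˢ reductˢ em I H → ∀ F → F ∈ H → J ⊩ F
  ⊨ˢ-reductˢ⁻ x F F∈H = x (reduct em I F) (F , F∈H , ≈ᵉ-refl (reductᵉ em I (expr F)))

  ⊨ˢ-reductˢ⁺ : ∀ {h J} {H : Pred (Formula σ) h} →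
    (∀ F → F ∈ H → J ⊩ F) → J ⊨ˢ reductˢ em I H
  ⊨ˢ-reductˢ⁺ {J = J} x F (G , G∈H , F≈Gᴵ) =
    ⊨-resp-≈ᵉ J (expr (reduct em I G)) (expr F)
      (≈ᵉ-sym (expr F) (expr (reduct em I G)) F≈Gᴵ) (x G G∈H)

  ⊩-∪-⟦⟧ : ∀ {h J} {H : Pred (Formula σ) h} F →
    (∀ G → G ∈ H → J ⊩ G) → J ⊩ F → ∀ G → G ∈ H ∪ ⟦ F ⟧ → J ⊩ G
  ⊩-∪-⟦⟧ F x f G = [ x G , (λ F≈G → ⊩-resp-≈ {F = F} {G} F≈G f) ]′

open HereAndThere

-- Stability of I depends on the set only through the class of J satisfying its reduct. Minimality
-- transfers contravariantly: each competitor J is carried back to the original set.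
stable-⇔ : ∀ {ℓ h h′} (em : ExcludedMiddle ℓ) {σ : Set ℓ}
  {H : Pred (Formula σ) h} {H′ : Pred (Formula σ) h′} →
  (∀ I J → (∀ F → F ∈ H → _⊩_ em I J F) ⇔ (∀ F → F ∈ H′ → _⊩_ em I J F)) →
  SameStableModels em H H′
stable-⇔ em {σ} {H} {H′} eqv I = mk⇔
  (λ (x , minimal) → to′ x , λ J → minimal J ∘ from′)
  (λ (x , minimal) → from′ x , λ J → minimal J ∘ to′)
  where
  to′ : ∀ {J} → J ⊨ˢ reductˢ em I H → J ⊨ˢ reductˢ em I H′
  to′ {J} = ⊨ˢ-reductˢ⁺ em I ∘ Equivalence.to (eqv I J) ∘ ⊨ˢ-reductˢ⁻ em I
  from′ : ∀ {J} → J ⊨ˢ reductˢ em I H′ → J ⊨ˢ reductˢ em I H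
  from′ {J} = ⊨ˢ-reductˢ⁺ em I ∘ Equivalence.from (eqv I J) ∘ ⊨ˢ-reductˢ⁻ em I

mainTheorem2 : ∀ {ℓ h} (em : ExcludedMiddle ℓ) (σ : Set ℓ)
    (H : Pred (Formula σ) h) (F G : Formula σ) →
    (Theorem F → SameStableModels em (H ∪ ⟦ F ⟧) H) ×
    (Equivalent F G → SameStableModels em (H ∪ ⟦ F ⟧) (H ∪ ⟦ G ⟧))
mainTheorem2 em σ H F G =
  (λ ⊢F → stable-⇔ em λ I J → mk⇔
    (λ x E → x E ∘ inj₁)
    (λ x → ⊩-∪-⟦⟧ em I F x (soundness em I ⊢F []))) ,
  (λ ⊢F⟷G → stable-⇔ em λ I J →
    let J⊩F⟷G = soundness em I {J} ⊢F⟷G [] in mk⇔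
    -- The two indices select the two conjuncts of `F ⟷ G`.
    (replace I F G (J⊩F⟷G (lift true)))
    (replace I G F (J⊩F⟷G (lift false))))
  where
  replace : ∀ I {J} F G → _⊩_ em I J (F ⟶ G) →
    (∀ E → E ∈ H ∪ ⟦ F ⟧ → _⊩_ em I J E) → ∀ E → E ∈ H ∪ ⟦ G ⟧ → _⊩_ em I J E
  replace I F G F⟶G x = ⊩-∪-⟦⟧ em I G (λ E → x E ∘ inj₁)
    (⊩-⟶⁻ em I F G F⟶G (x F (inj₂ (≈ᵉ-refl (expr F)))))
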